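{- Let $t\ge1$, let $k_1,\ldots,k_t\ge 2$ be integers and $\kappa:=\sum_{i=1}^t(k_i-1)$. If $G$ is a graph with $n$ vertices that does not contain $C_{2k_1,2k_2,\ldots,2k_t}$ as a subgraph, then $$\sum_{u\in V(G)} d_G(u)^2<(4\kappa+t)(n-1)n.$$
   Context: $d_G(u)$ is the degree of $u$ in $G$. $C_{2k_1,\ldots,2k_t}$ is the graph obtained from cycles $C_{2k_1},\ldots,C_{2k_t}$ intersecting in exactly one common vertex.
   Formalization: The formal statement assumes n ≥ 2; for n = 0 or n = 1 both sides of the inequality equal 0, so the strict inequality as stated fails. -}

module Defs where

open import Data.Nat using (ℕ; zero; suc; _+_; _*_; _∸_; _<_; _≤_)
open import Data.Bool using (Bool; true; false; if_then_else_)
open import Data.Fin using (Fin; toℕ)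
open import Data.List using (List; map; allFin)
open import Data.Nat.ListAction using (sum)
open import Data.Product using (Σ; _×_; ∃)
open import Data.Sum using (_⊎_)
open import Relation.Binary.PropositionalEquality using (_≡_)
open import Relation.Nullary using (¬_)

record Graph (n : ℕ) : Set where
  field
    adj     : Fin n → Fin n → Bool
    symm    : ∀ u v → adj u v ≡ adj v u
    irrefl  : ∀ u → adj u u ≡ false
open Graph public

ΣFin : (m : ℕ) → (Fin m → ℕ) → ℕ
ΣFin m f = sum (map f (allFin m))

degree : ∀ {n} → Graph n → Fin n → ℕ
degree {n} G u = ΣFin n (λ v → if adj G u v then 1 else 0)

-- Cycle adjacency inside the i-th cycle C_{2k_i}, whose vertices are
-- indexed by j ∈ {0, …, 2k_i − 1} (index 0 is the common vertex):
-- j and j' are consecutive around the cycle.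
CycleNext : (m : ℕ) → ℕ → ℕ → Set
CycleNext m j j' = (j' ≡ suc j) ⊎ ((j ≡ m ∸ 1) × (j' ≡ 0))

-- G contains C_{2k_1,…,2k_t} as a subgraph: an injective map from the
-- vertices of C_{2k_1,…,2k_t} into V(G) sending edges to edges.
-- The vertices of C_{2k_1,…,2k_t} are presented as pairs (i , j) with
-- j : Fin (2 k_i), where all pairs (i , 0) are identified (the common vertex).
record ContainsBouquet {n : ℕ} (G : Graph n) (t : ℕ) (k : Fin t → ℕ) : Set where
  field
    centre : Fin n
    f      : (i : Fin t) → Fin (2 * k i) → Fin n
    f-centre : ∀ i (j : Fin (2 * k i)) → toℕ j ≡ 0 → f i j ≡ centre
    f-edge : ∀ i (j j' : Fin (2 * k i)) → CycleNext (2 * k i) (toℕ j) (toℕ j') →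
             adj G (f i j) (f i j') ≡ true
    f-inj  : ∀ i i' (j : Fin (2 * k i)) (j' : Fin (2 * k i')) → f i j ≡ f i' j' →
             ((toℕ j ≡ 0) × (toℕ j' ≡ 0)) ⊎ ((i ≡ i') × (toℕ j ≡ toℕ j'))

kappa : (t : ℕ) → (Fin t → ℕ) → ℕ
kappa t k = ΣFin t (λ i → k i ∸ 1)

{-# OPTIONS --safe #-}

-- Fix a vertex v and list the ordered edges (x , y) with x ∈ N(v) and y ≠ v as
-- the entries of a 0-1 matrix. Place the vertices on a circle and alternately
-- delete, in every column and in every row, the entry whose clockwise arc from
-- x to y is shortest; one round deletes at most n − 1 entries. An entry that
-- survives L rounds can be traced back through the deleted ones: the arcs shrink
-- strictly, so this spells out a path z₀ z₁ z₂ … with distinct vertices whose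
-- even terms lie in N(v). With L + 1 = 2 (κ + t) the path is long enough to be
-- cut into t segments of 2 kᵢ − 1 vertices (omitting one vertex after each), all
-- with both ends in N(v), and v closes them to the required cycles. Hence every
-- v satisfies Σ_{x ∈ N(v)} d(x) < (4κ + t)(n − 1), and summing over v gives Σ d².
module Submission where

open import Defs
open import Data.Bool using (Bool; true; false; if_then_else_; _∧_; not)
open import Data.Bool.Properties using (∧-conicalˡ; ∧-conicalʳ; ∧-zeroʳ) renaming (_≟_ to _≟ᵇ_)
open import Data.Empty using (⊥-elim)
open import Data.Fin using (Fin; zero; suc; toℕ)
open import Data.Fin.Properties using (any?; toℕ-injective; toℕ<n) renaming (suc-injective to sucᶠ-injective; _≟_ to _≟ᶠ_)
open import Data.List.Properties using (map-tabulate)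
open import Data.Nat using (ℕ; zero; suc; _+_; _*_; _∸_; _^_; _<_; _≤_; z≤n; s≤s; s≤s⁻¹; z<s; _≤?_; _<?_)
open import Data.Nat.ListAction using (sum)
open import Data.Nat.Properties hiding (_≤?_; _<?_)
open import Data.Nat.Solver using (module +-*-Solver)
open import Data.Product using (_×_; _,_; ∃; proj₁; proj₂)
open import Data.Sum using (_⊎_; inj₁; inj₂)
open import Function using (id; _∘_)
open import Relation.Binary using (tri<; tri≈; tri>)
open import Relation.Binary.PropositionalEquality
open import Relation.Nullary using (¬_; Dec; yes; no; does; contradiction)
open import Relation.Nullary.Decidable using (_×-dec_; dec-true)
open +-*-Solver using (solve; _:+_; _:*_; _:=_; con)

-- Finite sums

⟦_⟧ : Bool → ℕ
⟦ b ⟧ = if b then 1 else 0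

⟦⟧≤1 : ∀ b → ⟦ b ⟧ ≤ 1
⟦⟧≤1 true  = ≤-refl
⟦⟧≤1 false = z≤n

0<⟦⟧⇒true : ∀ b → 0 < ⟦ b ⟧ → b ≡ true
0<⟦⟧⇒true true _ = refl

-- `allFin` is a tabulation, so this recursion is not definitional; both tails fuse to a tabulation
-- of `f ∘ suc`.
ΣFin-suc : ∀ m (f : Fin (suc m) → ℕ) → ΣFin (suc m) f ≡ f zero + ΣFin m (f ∘ suc)
ΣFin-suc m f = cong (λ l → f zero + sum l)
  (trans (map-tabulate suc f) (sym (map-tabulate id (f ∘ suc))))

ΣFin-mono : ∀ m {f g : Fin m → ℕ} → (∀ i → f i ≤ g i) → ΣFin m f ≤ ΣFin m g
ΣFin-mono zero    f≤g = z≤n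
ΣFin-mono (suc m) {f} {g} f≤g rewrite ΣFin-suc m f | ΣFin-suc m g =
  +-mono-≤ (f≤g zero) (ΣFin-mono m (f≤g ∘ suc))

ΣFin-cong : ∀ m {f g : Fin m → ℕ} → (∀ i → f i ≡ g i) → ΣFin m f ≡ ΣFin m g
ΣFin-cong m f≗g = ≤-antisym (ΣFin-mono m (≤-reflexive ∘ f≗g)) (ΣFin-mono m (≤-reflexive ∘ sym ∘ f≗g))

ΣFin-+ : ∀ m (f g : Fin m → ℕ) → ΣFin m (λ i → f i + g i) ≡ ΣFin m f + ΣFin m g
ΣFin-+ zero    f g = refl
ΣFin-+ (suc m) f g rewrite ΣFin-suc m (λ i → f i + g i) | ΣFin-suc m f | ΣFin-suc m g
                         | ΣFin-+ m (f ∘ suc) (g ∘ suc) =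
  solve 4 (λ a b c d → a :+ b :+ (c :+ d) := a :+ c :+ (b :+ d)) refl (f zero) (g zero) _ _

ΣFin-const : ∀ m c → ΣFin m (λ _ → c) ≡ m * c
ΣFin-const zero    c = refl
ΣFin-const (suc m) c = trans (ΣFin-suc m (λ _ → c)) (cong (c +_) (ΣFin-const m c))

ΣFin-*ʳ : ∀ m (f : Fin m → ℕ) c → ΣFin m (λ i → f i * c) ≡ ΣFin m f * c
ΣFin-*ʳ zero    f c = refl
ΣFin-*ʳ (suc m) f c rewrite ΣFin-suc m (λ i → f i * c) | ΣFin-suc m f | ΣFin-*ʳ m (f ∘ suc) c =
  sym (*-distribʳ-+ c (f zero) _)

ΣFin-swap : ∀ m l (f : Fin m → Fin l → ℕ) →
  ΣFin m (λ i → ΣFin l (f i)) ≡ ΣFin l (λ j → ΣFin m (λ i → f i j))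
ΣFin-swap zero    l f = sym (trans (ΣFin-const l 0) (*-zeroʳ l))
ΣFin-swap (suc m) l f = begin
  ΣFin (suc m) (λ i → ΣFin l (f i))
    ≡⟨ ΣFin-suc m _ ⟩
  ΣFin l (f zero) + ΣFin m (λ i → ΣFin l (f (suc i)))
    ≡⟨ cong (ΣFin l (f zero) +_) (ΣFin-swap m l (f ∘ suc)) ⟩
  ΣFin l (f zero) + ΣFin l (λ j → ΣFin m (λ i → f (suc i) j))
    ≡⟨ sym (ΣFin-+ l _ _) ⟩
  ΣFin l (λ j → f zero j + ΣFin m (λ i → f (suc i) j))
    ≡⟨ ΣFin-cong l (λ j → sym (ΣFin-suc m (λ i → f i j))) ⟩
  ΣFin l (λ j → ΣFin (suc m) (λ i → f i j)) ∎
  where open ≡-Reasoning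

ΣFin-pos : ∀ m (f : Fin m → ℕ) → 0 < ΣFin m f → ∃ λ i → 0 < f i
ΣFin-pos (suc m) f 0<Σ with 0 <? f zero
... | yes 0<f0 = zero , 0<f0
... | no  0≮f0 with ΣFin-pos m (f ∘ suc) (subst (0 <_)
                      (trans (ΣFin-suc m f) (cong (_+ ΣFin m (f ∘ suc)) (n≤0⇒n≡0 (≮⇒≥ 0≮f0)))) 0<Σ)
...   | i , 0<fi = suc i , 0<fi

ΣFin-< : ∀ m (f : Fin m → ℕ) c → 1 ≤ m → (∀ i → f i < c) → ΣFin m f < c * m
ΣFin-< m f c 1≤m f<c = begin
  1 + ΣFin m f              ≤⟨ +-monoˡ-≤ _ 1≤m ⟩
  m + ΣFin m f              ≡⟨ cong (_+ ΣFin m f) (sym (trans (ΣFin-const m 1) (*-identityʳ m))) ⟩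
  ΣFin m (λ _ → 1) + ΣFin m f ≡⟨ sym (ΣFin-+ m _ f) ⟩
  ΣFin m (λ i → suc (f i))  ≤⟨ ΣFin-mono m f<c ⟩
  ΣFin m (λ _ → c)          ≡⟨ trans (ΣFin-const m c) (*-comm m c) ⟩
  c * m                     ∎
  where open ≤-Reasoning

ΣFin-unique : ∀ m (p : Fin m → Bool) → (∀ i j → p i ≡ true → p j ≡ true → i ≡ j) →
  ΣFin m (λ i → ⟦ p i ⟧) ≤ 1
ΣFin-unique zero    p uniq = z≤n
ΣFin-unique (suc m) p uniq rewrite ΣFin-suc m (λ i → ⟦ p i ⟧) with p zero in eq
... | false = ΣFin-unique m (p ∘ suc) λ i j pi pj → sucᶠ-injective (uniq _ _ pi pj)
... | true  = s≤s (begin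
  ΣFin m (λ i → ⟦ p (suc i) ⟧) ≤⟨ ΣFin-mono m (λ i → none i) ⟩
  ΣFin m (λ _ → 0)             ≡⟨ trans (ΣFin-const m 0) (*-zeroʳ m) ⟩
  0                            ∎)
  where
  open ≤-Reasoning
  none : ∀ i → ⟦ p (suc i) ⟧ ≤ 0
  none i with p (suc i) in eq′
  ... | false = z≤n
  ... | true with () ← uniq zero (suc i) eq eq′

ΣFin-missing : ∀ m (f : Fin m → ℕ) v → (∀ i → f i ≤ 1) → f v ≡ 0 → ΣFin m f ≤ m ∸ 1
ΣFin-missing (suc m) f zero f≤1 fv rewrite ΣFin-suc m f | fv = begin
  ΣFin m (f ∘ suc) ≤⟨ ΣFin-mono m (f≤1 ∘ suc) ⟩
  ΣFin m (λ _ → 1) ≡⟨ trans (ΣFin-const m 1) (*-identityʳ m) ⟩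
  m                ∎
  where open ≤-Reasoning
ΣFin-missing (suc (suc m)) f (suc v) f≤1 fv rewrite ΣFin-suc (suc m) f =
  +-mono-≤ (f≤1 zero) (ΣFin-missing (suc m) (f ∘ suc) v (f≤1 ∘ suc) fv)

-- Arcs on a circle

-- The interface is closed under swapping the arguments of `δ`, so row and column rounds can share
-- one induction. `splitˡ` and `splitʳ` reflect that of two arcs with a common end the shorter is
-- contained in the longer.
record IsArcLength {n} (δ : Fin n → Fin n → ℕ) : Set where
  field
    δ-refl   : ∀ x → δ x x ≡ 0
    triangle : ∀ x z y → δ x y ≤ δ x z + δ z y
    splitˡ   : ∀ {x x′ y} → δ x′ y ≤ δ x y → δ x x′ + δ x′ y ≤ δ x y
    splitʳ   : ∀ {x y y′} → δ x y′ ≤ δ x y → δ x y′ + δ y′ y ≤ δ x y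
    injˡ     : ∀ {x x′ y} → δ x y ≡ δ x′ y → x ≡ x′
    injʳ     : ∀ {x y y′} → δ x y ≡ δ x y′ → y ≡ y′

flip-arcLength : ∀ {n} {δ : Fin n → Fin n → ℕ} → IsArcLength δ → IsArcLength (λ x y → δ y x)
flip-arcLength {δ = δ} arc = record
  { δ-refl   = δ-refl
  ; triangle = λ x z y → ≤-trans (triangle y z x) (≤-reflexive (+-comm (δ y z) (δ z x)))
  ; splitˡ   = λ {x} {x′} {y} le → ≤-trans (≤-reflexive (+-comm (δ x′ x) (δ y x′))) (splitʳ le)
  ; splitʳ   = λ {x} {y} {y′} le → ≤-trans (≤-reflexive (+-comm (δ y′ x) (δ y y′))) (splitˡ le)
  ; injˡ     = injʳ
  ; injʳ     = injˡ
  } where open IsArcLength arc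

clockwise : ∀ {n} → Fin n → Fin n → ℕ
clockwise {n} x y with toℕ x ≤? toℕ y
... | yes _ = toℕ y ∸ toℕ x
... | no  _ = n + toℕ y ∸ toℕ x

module _ {n : ℕ} where

  -- `d` is the residue of `y - x` modulo `n`, stated without truncated subtraction: positions are
  -- below `n`, so at most one full turn is added.
  Spans : Fin n → Fin n → ℕ → Set
  Spans x y d = d < n × ((d + toℕ x ≡ toℕ y) ⊎ (d + toℕ x ≡ n + toℕ y))

  clockwise-spans : ∀ x y → Spans x y (clockwise x y)
  clockwise-spans x y with toℕ x ≤? toℕ y
  ... | yes x≤y = ≤-<-trans (m∸n≤m _ (toℕ x)) (toℕ<n y) , inj₁ (m∸n+n≡m x≤y)
  ... | no  x≰y = +-cancelʳ-< (toℕ x) _ n (subst (_< n + toℕ x) (sym eq) (+-monoʳ-< n (≰⇒> x≰y))) , inj₂ eq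
    where
    eq : n + toℕ y ∸ toℕ x + toℕ x ≡ n + toℕ y
    eq = m∸n+n≡m (≤-trans (<⇒≤ (toℕ<n x)) (m≤m+n n _))

  offset-impossible : ∀ {a b} → b < n → ¬ (n + a ≡ b)
  offset-impossible {a} b<n refl = m+n≮m n a b<n

  spans-unique : ∀ {x y d e} → Spans x y d → Spans x y e → d ≡ e
  spans-unique {x} {y} (_ , inj₁ p) (_ , inj₁ q) = +-cancelʳ-≡ (toℕ x) _ _ (trans p (sym q))
  spans-unique {x} {y} (_ , inj₂ p) (_ , inj₂ q) = +-cancelʳ-≡ (toℕ x) _ _ (trans p (sym q))
  spans-unique {x} {y} {d} {e} (_ , inj₁ p) (e<n , inj₂ q) = ⊥-elim (offset-impossible e<n
    (+-cancelʳ-≡ (toℕ x) _ _ (trans (+-assoc n d _) (trans (cong (n +_) p) (sym q)))))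
  spans-unique {x} {y} {d} {e} (d<n , inj₂ p) (_ , inj₁ q) = ⊥-elim (offset-impossible d<n
    (+-cancelʳ-≡ (toℕ x) _ _ (trans (+-assoc n e _) (trans (cong (n +_) q) (sym p)))))

  spans⇒clockwise : ∀ {x y d} → Spans x y d → clockwise x y ≡ d
  spans⇒clockwise {x} {y} s = spans-unique {x} {y} (clockwise-spans x y) s

  spans-restˡ : ∀ {x x′ y d e} → Spans x y (d + e) → Spans x′ y e → Spans x x′ d
  spans-restˡ {x} {x′} {y} {d} {e} (de<n , p) (_ , q) = ≤-<-trans (m≤m+n d e) de<n , rest p q
    where
    shift : ∀ c → c + (d + toℕ x) + e ≡ c + (d + e + toℕ x)
    shift c = solve 4 (λ c d x e → c :+ (d :+ x) :+ e := c :+ (d :+ e :+ x)) refl c d (toℕ x) e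
    rest : (d + e + toℕ x ≡ toℕ y) ⊎ (d + e + toℕ x ≡ n + toℕ y) →
           (e + toℕ x′ ≡ toℕ y) ⊎ (e + toℕ x′ ≡ n + toℕ y) →
           (d + toℕ x ≡ toℕ x′) ⊎ (d + toℕ x ≡ n + toℕ x′)
    rest (inj₁ p) (inj₁ q) = inj₁ (+-cancelʳ-≡ e _ _ (trans (shift 0) (trans p (trans (sym q) (+-comm e _)))))
    rest (inj₂ p) (inj₂ q) = inj₁ (+-cancelʳ-≡ e _ _ (trans (shift 0) (trans p (trans (sym q) (+-comm e _)))))
    rest (inj₂ p) (inj₁ q) = inj₂ (+-cancelʳ-≡ e _ _ (trans (shift 0) (trans p
      (trans (cong (n +_) (trans (sym q) (+-comm e _))) (sym (+-assoc n _ e))))))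
    -- If the long arc does not wrap but its final part does, the position of `x′` would be at least
    -- `n`.
    rest (inj₁ p) (inj₂ q) = ⊥-elim (offset-impossible (toℕ<n x′)
      (+-cancelʳ-≡ e _ _ (trans (shift n) (trans (cong (n +_) p) (trans (sym q) (+-comm e _))))))

  spans-restʳ : ∀ {x y y′ d e} → Spans x y (d + e) → Spans x y′ e → Spans y′ y d
  spans-restʳ {x} {y} {y′} {d} {e} (de<n , p) (_ , q) = ≤-<-trans (m≤m+n d e) de<n , rest p q
    where
    rest : (d + e + toℕ x ≡ toℕ y) ⊎ (d + e + toℕ x ≡ n + toℕ y) →
           (e + toℕ x ≡ toℕ y′) ⊎ (e + toℕ x ≡ n + toℕ y′) →
           (d + toℕ y′ ≡ toℕ y) ⊎ (d + toℕ y′ ≡ n + toℕ y)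
    rest (inj₁ p) (inj₁ q) = inj₁ (trans (cong (d +_) (sym q)) (trans (sym (+-assoc d e _)) p))
    rest (inj₂ p) (inj₁ q) = inj₂ (trans (cong (d +_) (sym q)) (trans (sym (+-assoc d e _)) p))
    rest (inj₁ p) (inj₂ q) = ⊥-elim (offset-impossible (toℕ<n y) (trans
      (solve 3 (λ n d y → n :+ (d :+ y) := d :+ (n :+ y)) refl n d (toℕ y′))
      (trans (cong (d +_) (sym q)) (trans (sym (+-assoc d e _)) p))))
    rest (inj₂ p) (inj₂ q) = inj₁ (+-cancelˡ-≡ n _ _ (trans
      (solve 3 (λ n d y → n :+ (d :+ y) := d :+ (n :+ y)) refl n d (toℕ y′))
      (trans (cong (d +_) (sym q)) (trans (sym (+-assoc d e _)) p))))

  spans-zero : ∀ {x y} → Spans x y 0 → x ≡ y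
  spans-zero (_ , inj₁ p) = toℕ-injective p
  spans-zero {x} (_ , inj₂ p) = ⊥-elim (offset-impossible (toℕ<n x) (sym p))

  -- If `z` is no farther from `y` than `x` is, it lies on the arc and equality holds; otherwise the
  -- second summand alone suffices.
  clockwise-triangle : ∀ (x z y : Fin n) → clockwise x y ≤ clockwise x z + clockwise z y
  clockwise-triangle x z y with ≤-total (clockwise z y) (clockwise x y)
  ... | inj₂ le = ≤-trans le (m≤n+m _ _)
  ... | inj₁ le = ≤-reflexive (sym (trans
    (cong (_+ clockwise z y) (spans⇒clockwise {x} {z} (spans-restˡ {x} {z} {y}
      (subst (Spans x y) (sym (m∸n+n≡m le)) (clockwise-spans x y)) (clockwise-spans z y))))
    (m∸n+n≡m le)))

  clockwise-arcLength : IsArcLength {n} clockwise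
  clockwise-arcLength = record
    { δ-refl   = λ x → spans⇒clockwise {x} {x} (≤-<-trans z≤n (toℕ<n x) , inj₁ refl)
    ; triangle = clockwise-triangle
    ; splitˡ   = λ {x} {x′} {y} le → ≤-reflexive (trans
        (cong (_+ clockwise x′ y) (spans⇒clockwise {x} {x′} (restˡ {x} {x′} {y} le))) (m∸n+n≡m le))
    ; splitʳ   = λ {x} {y} {y′} le → ≤-reflexive (trans
        (cong (clockwise x y′ +_) (spans⇒clockwise {y′} {y} (restʳ {x} {y} {y′} le))) (m+[n∸m]≡n le))
    -- Equal lengths leave an arc of length 0 from `x` to `x′`.
    ; injˡ     = λ {x} {x′} {y} eq → spans-zero {x} {x′} (subst (Spans x x′)
        (trans (cong (_∸ clockwise x′ y) eq) (n∸n≡0 (clockwise x′ y))) (restˡ {x} {x′} {y} (≤-reflexive (sym eq))))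
    ; injʳ     = λ {x} {y} {y′} eq → spans-zero {y} {y′} (subst (Spans y y′)
        (trans (cong (clockwise x y′ ∸_) eq) (n∸n≡0 (clockwise x y′))) (restʳ {x} {y′} {y} (≤-reflexive eq)))
    }
    where
    restˡ : ∀ {x x′ y} → clockwise x′ y ≤ clockwise x y → Spans x x′ (clockwise x y ∸ clockwise x′ y)
    restˡ {x} {x′} {y} le = spans-restˡ {x} {x′} {y}
      (subst (Spans x y) (sym (m∸n+n≡m le)) (clockwise-spans x y)) (clockwise-spans x′ y)
    restʳ : ∀ {x y y′} → clockwise x y′ ≤ clockwise x y → Spans y′ y (clockwise x y ∸ clockwise x y′)
    restʳ {x} {y} {y′} le = spans-restʳ {x} {y} {y′}
      (subst (Spans x y) (sym (m∸n+n≡m le)) (clockwise-spans x y)) (clockwise-spans x y′)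

-- Pruning a 0-1 matrix

beaten? : ∀ {n} (p : Fin n → Bool) (key : Fin n → ℕ) x → Dec (∃ λ x′ → p x′ ≡ true × key x′ < key x)
beaten? p key x = any? (λ x′ → (p x′ ≟ᵇ true) ×-dec (key x′ <? key x))

-- Survival means that a smaller entry exists, instead of comparison with a computed minimum: the
-- witness in `beaten?` later supplies the next entry of the path. It need not survive this round
-- itself.
dropMin : ∀ {n} → (Fin n → Bool) → (Fin n → ℕ) → Fin n → Bool
dropMin p key x = p x ∧ does (beaten? p key x)

dropMin-⊆ : ∀ {n} (p : Fin n → Bool) key x → p x ≡ false → dropMin p key x ≡ false
dropMin-⊆ p key x px = cong (_∧ does (beaten? p key x)) px

-- A deleted entry is unbeaten, and two unbeaten entries would have equal keys.
dropMin-count : ∀ n (p : Fin n → Bool) (key : Fin n → ℕ) → (∀ {x x′} → key x ≡ key x′ → x ≡ x′) →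
  ΣFin n (λ x → ⟦ p x ⟧) ≤ ΣFin n (λ x → ⟦ dropMin p key x ⟧) + 1
dropMin-count n p key key-inj = begin
  ΣFin n (λ x → ⟦ p x ⟧)
    ≤⟨ ΣFin-mono n (λ x → split (p x) (does (beaten? p key x))) ⟩
  ΣFin n (λ x → ⟦ dropMin p key x ⟧ + ⟦ isMin x ⟧)
    ≡⟨ ΣFin-+ n _ _ ⟩
  ΣFin n (λ x → ⟦ dropMin p key x ⟧) + ΣFin n (λ x → ⟦ isMin x ⟧)
    ≤⟨ +-monoʳ-≤ _ (ΣFin-unique n isMin isMin-unique) ⟩
  ΣFin n (λ x → ⟦ dropMin p key x ⟧) + 1 ∎
  where
  open ≤-Reasoning
  isMin : Fin n → Bool
  isMin x = p x ∧ not (does (beaten? p key x))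
  split : ∀ b c → ⟦ b ⟧ ≤ ⟦ b ∧ c ⟧ + ⟦ b ∧ not c ⟧
  split false c     = z≤n
  split true  true  = ≤-refl
  split true  false = ≤-refl
  unbeaten : ∀ x x′ → isMin x ≡ true → p x′ ≡ true → ¬ key x′ < key x
  unbeaten x x′ min px′ lt
    with () ← trans (sym (∧-conicalʳ (p x) _ min)) (cong not (dec-true (beaten? p key x) (x′ , px′ , lt)))
  isMin-unique : ∀ x y → isMin x ≡ true → isMin y ≡ true → x ≡ y
  isMin-unique x y mx my with <-cmp (key x) (key y)
  ... | tri< lt _ _ = contradiction lt (unbeaten y x my (∧-conicalˡ (p x) _ mx))
  ... | tri≈ _ eq _ = key-inj eq
  ... | tri> _ _ gt = contradiction gt (unbeaten x y mx (∧-conicalˡ (p y) _ my))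

Matrix : ℕ → Set
Matrix n = Fin n → Fin n → Bool

total : ∀ {n} → Matrix n → ℕ
total {n} E = ΣFin n (λ x → ΣFin n (λ y → ⟦ E x y ⟧))

flipM : ∀ {n} {A : Set} → (Fin n → Fin n → A) → Fin n → Fin n → A
flipM E x y = E y x

total-flip : ∀ {n} (E : Matrix n) → total (flipM E) ≡ total E
total-flip {n} E = ΣFin-swap n n (λ x y → ⟦ E y x ⟧)

-- Transposing both the matrix and the arcs exchanges the row and column rounds;
-- the outermost round of prune (suc L) acts on columns.
prune : ∀ {n} → ℕ → (Fin n → Fin n → ℕ) → Matrix n → Matrix n
prune zero    δ E x y = E x y
prune (suc L) δ E x y = dropMin (λ x′ → prune L (flipM δ) (flipM E) y x′) (λ x′ → δ x′ y) x

module _ {n : ℕ} (v : Fin n) where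

  -- Row and column are both required to be empty so that the condition survives transposition.
  Avoids : Matrix n → Set
  Avoids E = ∀ x → E x v ≡ false × E v x ≡ false

  prune-avoids : ∀ L δ {E} → Avoids E → Avoids (prune L δ E)
  prune-avoids zero    δ av = av
  prune-avoids (suc L) δ {E} av x =
    dropMin-⊆ (H v) (λ x′ → δ x′ v) x (proj₂ (IH x)) ,
    dropMin-⊆ (H x) (λ x′ → δ x′ x) v (proj₁ (IH x))
    where
    H : Matrix n
    H = prune L (flipM δ) (flipM E)
    IH : Avoids H
    IH = prune-avoids L (flipM δ) (λ z → proj₂ (av z) , proj₁ (av z))

  -- Each round deletes at most one entry from each of the `n` lines it treats, and the line of `v`
  -- is empty from the start.
  prune-count : ∀ L {δ} → IsArcLength δ → ∀ {E} → Avoids E →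
    total E ≤ total (prune L δ E) + L * (n ∸ 1)
  prune-count zero    arc {E} av = m≤m+n _ 0
  prune-count (suc L) {δ} arc {E} av = begin
    total E
      ≡⟨ sym (total-flip E) ⟩
    total (flipM E)
      ≤⟨ prune-count L (flip-arcLength arc) av′ ⟩
    total H + L * (n ∸ 1)
      ≤⟨ +-monoˡ-≤ (L * (n ∸ 1)) round ⟩
    total (prune (suc L) δ E) + (n ∸ 1) + L * (n ∸ 1)
      ≡⟨ +-assoc (total (prune (suc L) δ E)) (n ∸ 1) (L * (n ∸ 1)) ⟩
    total (prune (suc L) δ E) + suc L * (n ∸ 1) ∎
    where
    open ≤-Reasoning
    av′ : Avoids (flipM E)
    av′ z = proj₂ (av z) , proj₁ (av z)
    H : Matrix n
    H = prune L (flipM δ) (flipM E)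
    other : Fin n → ℕ
    other y = ⟦ not (does (y ≟ᶠ v)) ⟧
    -- Column `y` is row `y` of the transposed `H`; `other y` is the loss allowed there, 0 for
    -- `y = v`.
    column : ∀ y → ΣFin n (λ x → ⟦ H y x ⟧) ≤ ΣFin n (λ x → ⟦ prune (suc L) δ E x y ⟧) + other y
    column y with y ≟ᶠ v
    ... | no  _    = dropMin-count n (H y) (λ x → δ x y) (IsArcLength.injˡ arc)
    ... | yes refl = ≤-trans
      (ΣFin-mono n (λ x → ≤-trans (≤-reflexive (cong ⟦_⟧ (proj₂ (prune-avoids L (flipM δ) av′ x)))) z≤n))
      (m≤m+n _ 0)
    round : total H ≤ total (prune (suc L) δ E) + (n ∸ 1)
    round = begin
      total H
        ≤⟨ ΣFin-mono n column ⟩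
      ΣFin n (λ y → ΣFin n (λ x → ⟦ prune (suc L) δ E x y ⟧) + other y)
        ≡⟨ ΣFin-+ n _ other ⟩
      total (flipM (prune (suc L) δ E)) + ΣFin n other
        ≤⟨ +-mono-≤ (≤-reflexive (total-flip (prune (suc L) δ E)))
             (ΣFin-missing n other v (λ y → ⟦⟧≤1 _)
               (cong (λ b → ⟦ not b ⟧) (dec-true (v ≟ᶠ v) refl))) ⟩
      total (prune (suc L) δ E) + (n ∸ 1) ∎

-- Zigzag paths

-- Even positions of a path are row indices and odd ones column indices, so step `i` reads `E` or
-- its transpose by the parity of `i`.
alternate : ∀ {n} → Matrix n → ℕ → Matrix n
alternate E zero    = E
alternate E (suc i) = alternate (flipM E) i

alternate-even : ∀ {n} (E : Matrix n) a → alternate E (2 * a) ≡ E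
alternate-even E zero    = refl
alternate-even E (suc a) rewrite +-suc a (a + 0) = alternate-even E a

alternate-sym : ∀ {n} {R : Fin n → Fin n → Set} → (∀ {x y} → R x y → R y x) →
  ∀ {E} → (∀ {x y} → E x y ≡ true → R x y) → ∀ i {x y} → alternate E i x y ≡ true → R x y
alternate-sym R-sym E⇒R zero    e = E⇒R e
alternate-sym R-sym E⇒R (suc i) e = alternate-sym R-sym (R-sym ∘ E⇒R) i e

-- The steps reach `z (suc L)`, but distinctness stops at `L`: a diagonal entry of `E` may make the
-- last vertex repeat its predecessor.
record Zigzag {n} (E : Matrix n) (L : ℕ) (z : ℕ → Fin n) : Set where
  field
    step     : ∀ {i} → i ≤ L → alternate E i (z i) (z (suc i)) ≡ true
    distinct : ∀ {i j} → i ≤ L → j ≤ L → z i ≡ z j → i ≡ j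

cons : ∀ {A : Set} → A → (ℕ → A) → ℕ → A
cons x z zero    = x
cons x z (suc i) = z i

prune⇒entry : ∀ {n} L {δ : Fin n → Fin n → ℕ} {E x y} → prune L δ E x y ≡ true → E x y ≡ true
prune⇒entry zero    e = e
prune⇒entry (suc L) {δ} {E} e = prune⇒entry L {flipM δ} {flipM E} (∧-conicalˡ _ _ e)

-- The arc inequality strengthens the induction: it keeps `z 0` to `z L` on the arc from `x` to `y`.
-- Undoing the last round gives `x′` strictly closer to `y`; the path obtained for it starts at `y`
-- and stays on the arc from `x′` to `y`. That arc cannot contain `x`, so `x` can be prepended.
prune⇒zigzag : ∀ {n} L {δ : Fin n → Fin n → ℕ} → IsArcLength δ → ∀ {E x y} → prune L δ E x y ≡ true →
  ∃ λ z → z 0 ≡ x × Zigzag E L z × (∀ {i} → i ≤ L → δ x (z i) + δ (z i) y ≤ δ x y)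
-- Only the values at 0 and 1 matter; the constant tail `y` is a default.
prune⇒zigzag zero {δ} arc {E} {x} {y} e = cons x (λ _ → y) , refl ,
  record { step = λ { z≤n → e } ; distinct = λ { z≤n z≤n _ → refl } } ,
  λ { z≤n → ≤-reflexive (cong (_+ δ x y) (IsArcLength.δ-refl arc x)) }
prune⇒zigzag (suc L) {δ} arc {E} {x} {y} e
  -- Matching the decision together with the proof that it is true rules out the case `no`.
  with beaten? (prune L (flipM δ) (flipM E) y) (λ x′ → δ x′ y) x | ∧-conicalʳ (prune L (flipM δ) (flipM E) y x) _ e
... | yes (x′ , e′ , δ<) | _
  with prune⇒zigzag L (flip-arcLength arc) {flipM E} {y} {x′} e′
... | z , z0 , zig , inside = cons x z , refl ,
  record { step = step′ ; distinct = distinct′ } , inside′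
  where
  open IsArcLength arc
  step′ : ∀ {i} → i ≤ suc L → alternate E i (cons x z i) (z i) ≡ true
  step′ {zero}  _       = trans (cong (E x) z0) (prune⇒entry (suc L) {δ} {E} e)
  step′ {suc i} (s≤s p) = Zigzag.step zig p
  x-fresh : ∀ {i} → i ≤ L → ¬ z i ≡ x
  x-fresh p refl = <-irrefl refl (<-≤-trans δ< (≤-trans (m≤m+n _ _) (inside p)))
  distinct′ : ∀ {i j} → i ≤ suc L → j ≤ suc L → cons x z i ≡ cons x z j → i ≡ j
  distinct′ {zero}  {zero}  _ _ _ = refl
  distinct′ {zero}  {suc j} _ (s≤s q) eq = ⊥-elim (x-fresh q (sym eq))
  distinct′ {suc i} {zero}  (s≤s p) _ eq = ⊥-elim (x-fresh p eq)
  distinct′ {suc i} {suc j} (s≤s p) (s≤s q) eq = cong suc (Zigzag.distinct zig p q eq)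
  open ≤-Reasoning
  inside′ : ∀ {i} → i ≤ suc L → δ x (cons x z i) + δ (cons x z i) y ≤ δ x y
  inside′ {zero}  _       = ≤-reflexive (cong (_+ δ x y) (δ-refl x))
  inside′ {suc i} (s≤s p) = begin
    -- The detour through `x′` costs nothing, since `x′` lies on the arc from `x` to `y`; `splitˡ`
    -- records this below.
    δ x (z i) + δ (z i) y              ≤⟨ +-monoˡ-≤ _ (triangle x x′ (z i)) ⟩
    δ x x′ + δ x′ (z i) + δ (z i) y    ≡⟨ +-assoc (δ x x′) _ _ ⟩
    δ x x′ + (δ x′ (z i) + δ (z i) y)  ≡⟨ cong (δ x x′ +_) (+-comm (δ x′ (z i)) _) ⟩
    δ x x′ + (δ (z i) y + δ x′ (z i))  ≤⟨ +-monoʳ-≤ (δ x x′) (inside p) ⟩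
    δ x x′ + δ x′ y                    ≤⟨ splitˡ (<⇒≤ δ<) ⟩
    δ x y                              ∎

exists-zigzag : ∀ {n} (v : Fin n) (E : Matrix n) L → Avoids v E → L * (n ∸ 1) < total E → ∃ (Zigzag E L)
exists-zigzag {n} v E L av lt =
  let P         = prune L clockwise E
      pos       = +-cancelʳ-< (L * (n ∸ 1)) 0 (total P)
                    (<-≤-trans lt (prune-count v L clockwise-arcLength av))
      x , posx  = ΣFin-pos n (λ x → ΣFin n (λ y → ⟦ P x y ⟧)) pos
      y , posxy = ΣFin-pos n (λ y → ⟦ P x y ⟧) posx
      z , _ , zig , _ = prune⇒zigzag L clockwise-arcLength {E} {x} {y} (0<⟦⟧⇒true _ posxy)
  in z , zig

-- Cutting a zigzag path into a bouquet

-- Half the index at which block `i` of the path begins. Blocks have length `2 * k i`, so each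
-- begins at an even index.
offset : (t : ℕ) → (Fin t → ℕ) → Fin t → ℕ
offset (suc t) k zero    = 0
offset (suc t) k (suc i) = k zero + offset t (k ∘ suc) i

offset-bound : ∀ t k i → offset t k i + k i ≤ ΣFin t k
offset-bound (suc t) k zero    rewrite ΣFin-suc t k = m≤m+n _ _
offset-bound (suc t) k (suc i) rewrite ΣFin-suc t k =
  ≤-trans (≤-reflexive (+-assoc (k zero) _ _)) (+-monoʳ-≤ (k zero) (offset-bound t (k ∘ suc) i))

-- The blocks are disjoint: indices in the first one are below `2 * k zero`, all later ones are not,
-- and peeling it off gives the induction.
offset-injective : ∀ t k i i′ {j j′} → j < 2 * k i → j′ < 2 * k i′ →
  2 * offset t k i + j ≡ 2 * offset t k i′ + j′ → i ≡ i′ × j ≡ j′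
offset-injective (suc t) k zero zero _ _ eq = refl , eq
offset-injective (suc t) k zero (suc i′) {j} {j′} j< _ eq = ⊥-elim (<⇒≱ j< (begin
  2 * k zero                                   ≤⟨ *-monoʳ-≤ 2 (m≤m+n (k zero) _) ⟩
  2 * (k zero + offset t (k ∘ suc) i′)         ≤⟨ m≤m+n _ j′ ⟩
  2 * (k zero + offset t (k ∘ suc) i′) + j′    ≡⟨ sym eq ⟩
  j                                            ∎))
  where open ≤-Reasoning
offset-injective (suc t) k (suc i) zero j< j′< eq with offset-injective (suc t) k zero (suc i) j′< j< (sym eq)
... | () , _
offset-injective (suc t) k (suc i) (suc i′) {j} {j′} j< j′< eq
  with offset-injective t (k ∘ suc) i i′ j< j′< (+-cancelˡ-≡ (2 * k zero) _ _
         (trans (sym (shift (offset t (k ∘ suc) i) j)) (trans eq (shift (offset t (k ∘ suc) i′) j′))))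
  where
  shift : ∀ a b → 2 * (k zero + a) + b ≡ 2 * k zero + (2 * a + b)
  shift a b = solve 3 (λ k a b → con 2 :* (k :+ a) :+ b := con 2 :* k :+ (con 2 :* a :+ b)) refl (k zero) a b
... | refl , eq′ = refl , eq′

module _ {n : ℕ} (G : Graph n) (v : Fin n) where

  -- Excluding `y = v` empties column `v`; row `v` is empty by irreflexivity. This gives `Avoids`
  -- and keeps the path away from `v`.
  spokes : Matrix n
  spokes x y = adj G v x ∧ (not (does (y ≟ᶠ v)) ∧ adj G x y)

  spokes-nbr : ∀ {x y} → spokes x y ≡ true → adj G v x ≡ true
  spokes-nbr {x} = ∧-conicalˡ (adj G v x) _

  -- A symmetric consequence of an entry, hence valid for every step of the path regardless of
  -- parity.
  Link : Fin n → Fin n → Set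
  Link x y = adj G x y ≡ true × ¬ x ≡ v × ¬ y ≡ v

  Link-sym : ∀ {x y} → Link x y → Link y x
  Link-sym {x} {y} (a , x≢v , y≢v) = trans (symm G y x) a , y≢v , x≢v

  spokes-avoids : Avoids v spokes
  spokes-avoids x =
    trans (cong (λ b → adj G v x ∧ (not b ∧ adj G x v)) (dec-true (v ≟ᶠ v) refl)) (∧-zeroʳ (adj G v x)) ,
    cong (_∧ (not (does (x ≟ᶠ v)) ∧ adj G v x)) (irrefl G v)

  spokes⇒Link : ∀ {x y} → spokes x y ≡ true → Link x y
  spokes⇒Link {x} {y} e =
    ∧-conicalʳ (not (does (y ≟ᶠ v))) _ (∧-conicalʳ (adj G v x) _ e) ,
    (λ { refl → false≢true (trans (sym (proj₂ (spokes-avoids y))) e) }) ,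
    (λ { refl → false≢true (trans (sym (proj₁ (spokes-avoids x))) e) })
    where
    false≢true : ¬ false ≡ true
    false≢true ()

  zigzag⇒bouquet : ∀ t k → (∀ i → 2 ≤ k i) → ∀ {L} → 2 * ΣFin t k ≤ suc L →
    ∀ {z} → Zigzag spokes L z → ContainsBouquet G t k
  zigzag⇒bouquet t k 2≤k {L} long {z} zig = record
    { centre   = v
    ; f        = λ i j → place i (toℕ j)
    ; f-centre = λ i j eq → cong (place i) eq
    ; f-edge   = λ i j j′ → edge i (toℕ j) (toℕ j′) (toℕ<n j) (toℕ<n j′)
    ; f-inj    = λ i i′ j j′ → inj i i′ (toℕ j) (toℕ j′) (toℕ<n j) (toℕ<n j′)
    }
    where
    open Zigzag zig
    first : Fin t → ℕ
    first i = 2 * offset t k i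
    place : Fin t → ℕ → Fin n
    -- Position 0 is the centre, which shifts the block by one; the last of its `2 * k i` vertices
    -- is skipped.
    place i = cons v (λ j → z (first i + j))
    bound : ∀ i j → j < 2 * k i → first i + j ≤ L
    bound i j j< = s≤s⁻¹ (begin
      suc (first i + j)         ≡⟨ sym (+-suc (first i) j) ⟩
      first i + suc j           ≤⟨ +-monoʳ-≤ (first i) j< ⟩
      first i + 2 * k i         ≡⟨ sym (*-distribˡ-+ 2 (offset t k i) (k i)) ⟩
      2 * (offset t k i + k i)  ≤⟨ *-monoʳ-≤ 2 (offset-bound t k i) ⟩
      2 * ΣFin t k              ≤⟨ long ⟩
      suc L                     ∎)
      where open ≤-Reasoning
    link : ∀ m → m ≤ L → Link (z m) (z (suc m))
    link m m≤L = alternate-sym {R = Link} Link-sym {spokes} spokes⇒Link m (step m≤L)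
    even-nbr : ∀ a → 2 * a ≤ L → adj G v (z (2 * a)) ≡ true
    even-nbr a le = spokes-nbr {z (2 * a)} {z (suc (2 * a))}
      (subst (λ E → E (z (2 * a)) (z (suc (2 * a))) ≡ true) (alternate-even spokes a) (step le))
    nbr : ∀ i a → 2 * a < 2 * k i → adj G v (z (first i + 2 * a)) ≡ true
    nbr i a lt = subst (λ m → adj G v (z m) ≡ true) eq
      (even-nbr (offset t k i + a) (subst (_≤ L) (sym eq) (bound i (2 * a) lt)))
      where
      eq : 2 * (offset t k i + a) ≡ first i + 2 * a
      eq = *-distribˡ-+ 2 (offset t k i) a
    edge : ∀ i j j′ → j < 2 * k i → j′ < 2 * k i → CycleNext (2 * k i) j j′ →
           adj G (place i j) (place i j′) ≡ true
    edge i zero    _ j< _ (inj₁ refl) = nbr i 0 j<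
    edge i (suc j) _ j< _ (inj₁ refl) =
      subst (λ m → adj G (z (first i + j)) (z m) ≡ true) (sym (+-suc (first i) j))
        (proj₁ (link (first i + j) (bound i j (<-trans (n<1+n j) j<))))
    -- Closing edge: with `k i = q + 2`, the last position `2 * k i ∸ 1` holds the path vertex at
    -- distance `2 * suc q` from the block start. This is an even index, so the vertex is a
    -- neighbour of `v`.
    edge i j _ j< _ (inj₂ (eq , refl)) with k i | 2≤k i | nbr i
    ... | suc zero | s≤s () | _
    ... | suc (suc q) | _ | near with refl ← trans eq (+-suc (suc q) (suc q + 0)) =
      trans (symm G _ v) (near (suc q) (*-monoʳ-< 2 (n<1+n (suc q))))
    inj : ∀ i i′ j j′ → j < 2 * k i → j′ < 2 * k i′ → place i j ≡ place i′ j′ →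
          ((j ≡ 0) × (j′ ≡ 0)) ⊎ ((i ≡ i′) × (j ≡ j′))
    inj i i′ zero    zero     _  _   _  = inj₁ (refl , refl)
    inj i i′ zero    (suc j′) _  j′< eq =
      ⊥-elim (proj₁ (proj₂ (link _ (bound i′ j′ (<-trans (n<1+n j′) j′<)))) (sym eq))
    inj i i′ (suc j) zero     j< _   eq =
      ⊥-elim (proj₁ (proj₂ (link _ (bound i j (<-trans (n<1+n j) j<)))) eq)
    inj i i′ (suc j) (suc j′) j< j′< eq
      with offset-injective t k i i′ (<-trans (n<1+n j) j<) (<-trans (n<1+n j′) j′<)
             (distinct (bound i j (<-trans (n<1+n j) j<)) (bound i′ j′ (<-trans (n<1+n j′) j′<)) eq)
    ... | i≡i′ , j≡j′ = inj₂ (i≡i′ , cong suc j≡j′)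

  -- Degree sums over a neighbourhood

  nbrDegreeSum : ℕ
  nbrDegreeSum = ΣFin n (λ x → ⟦ adj G v x ⟧ * degree G x)

  degree≤n∸1 : degree G v ≤ n ∸ 1
  degree≤n∸1 = ΣFin-missing n _ v (λ x → ⟦⟧≤1 (adj G v x)) (cong ⟦_⟧ (irrefl G v))

  -- Only the pairs `(x , v)` are lost, one for each neighbour `x` of `v`.
  nbrDegreeSum≤spokes : nbrDegreeSum ≤ total spokes + (n ∸ 1)
  nbrDegreeSum≤spokes = begin
    nbrDegreeSum
      ≤⟨ ΣFin-mono n (λ x → row x) ⟩
    ΣFin n (λ x → ΣFin n (λ y → ⟦ spokes x y ⟧) + ⟦ adj G v x ⟧)
      ≡⟨ ΣFin-+ n _ _ ⟩
    total spokes + degree G v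
      ≤⟨ +-monoʳ-≤ (total spokes) degree≤n∸1 ⟩
    total spokes + (n ∸ 1) ∎
    where
    open ≤-Reasoning
    isv : Fin n → Bool
    isv y = does (y ≟ᶠ v)
    isv-sound : ∀ y → isv y ≡ true → y ≡ v
    isv-sound y e with yes y≡v ← y ≟ᶠ v = y≡v
    split : ∀ b c → ⟦ b ⟧ ≤ ⟦ not c ∧ b ⟧ + ⟦ c ⟧
    split b true  = ⟦⟧≤1 b
    split b false = m≤m+n _ 0
    row : ∀ x → ⟦ adj G v x ⟧ * degree G x ≤ ΣFin n (λ y → ⟦ spokes x y ⟧) + ⟦ adj G v x ⟧
    row x with adj G v x
    ... | false = z≤n
    ... | true  = begin
      degree G x + 0
        ≡⟨ +-identityʳ _ ⟩
      degree G x
        ≤⟨ ΣFin-mono n (λ y → split (adj G x y) (isv y)) ⟩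
      ΣFin n (λ y → ⟦ not (isv y) ∧ adj G x y ⟧ + ⟦ isv y ⟧)
        ≡⟨ ΣFin-+ n _ _ ⟩
      ΣFin n (λ y → ⟦ not (isv y) ∧ adj G x y ⟧) + ΣFin n (λ y → ⟦ isv y ⟧)
        ≤⟨ +-monoʳ-≤ _ (ΣFin-unique n isv (λ i j p q → trans (isv-sound i p) (sym (isv-sound j q)))) ⟩
      ΣFin n (λ y → ⟦ not (isv y) ∧ adj G x y ⟧) + 1 ∎

  nbrDegreeSum⇒bouquet : ∀ t k → (∀ i → 2 ≤ k i) → 1 ≤ ΣFin t k →
    2 * ΣFin t k * (n ∸ 1) < nbrDegreeSum → ContainsBouquet G t k
  nbrDegreeSum⇒bouquet t k 2≤k 1≤Σk lt =
    -- One of the `2 * ΣFin t k` multiples of `n ∸ 1` pays for the passage to `spokes`; the others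
    -- pay for the rounds. The path then has `suc L` distinct vertices, exactly the total block
    -- length.
    let L      = 2 * ΣFin t k ∸ 1
        1+L≡   : suc L ≡ 2 * ΣFin t k
        1+L≡   = m+[n∸m]≡n (≤-trans 1≤Σk (m≤m+n _ _))
        dense  : L * (n ∸ 1) < total spokes
        dense  = +-cancelʳ-< (n ∸ 1) _ _ (≤-<-trans (≤-reflexive (+-comm (L * (n ∸ 1)) (n ∸ 1)))
                   (<-≤-trans (subst (λ s → s * (n ∸ 1) < nbrDegreeSum) (sym 1+L≡) lt) nbrDegreeSum≤spokes))
        z , zig = exists-zigzag v spokes L spokes-avoids dense
    in zigzag⇒bouquet t k 2≤k (≤-reflexive (sym 1+L≡)) zig

-- Double counting: the degree of `u` is counted once for each neighbour `v` of `u`.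
Σ-nbrDegreeSum : ∀ {n} (G : Graph n) → ΣFin n (nbrDegreeSum G) ≡ ΣFin n (λ u → degree G u ^ 2)
Σ-nbrDegreeSum {n} G = trans (ΣFin-swap n n _) (ΣFin-cong n λ u → begin
  ΣFin n (λ v → ⟦ adj G v u ⟧ * degree G u)   ≡⟨ ΣFin-*ʳ n _ (degree G u) ⟩
  ΣFin n (λ v → ⟦ adj G v u ⟧) * degree G u   ≡⟨ cong (_* degree G u) (ΣFin-cong n λ v → cong ⟦_⟧ (symm G v u)) ⟩
  degree G u * degree G u                     ≡⟨ cong (degree G u *_) (sym (*-identityʳ _)) ⟩
  degree G u ^ 2                              ∎)
  where open ≡-Reasoning

-- Comparison of the constants and the final bound

t≤kappa : ∀ t k → (∀ i → 2 ≤ k i) → t ≤ kappa t k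
t≤kappa t k 2≤k = ≤-trans (≤-reflexive (sym (trans (ΣFin-const t 1) (*-identityʳ t))))
  (ΣFin-mono t (λ i → ∸-monoˡ-≤ 1 (2≤k i)))

Σk≡kappa+t : ∀ t k → (∀ i → 2 ≤ k i) → ΣFin t k ≡ kappa t k + t
Σk≡kappa+t t k 2≤k = begin
  ΣFin t k                                    ≡⟨ ΣFin-cong t (λ i → sym (m∸n+n≡m (≤-trans (n≤1+n 1) (2≤k i)))) ⟩
  ΣFin t (λ i → k i ∸ 1 + 1)                  ≡⟨ ΣFin-+ t _ _ ⟩
  kappa t k + ΣFin t (λ _ → 1)                ≡⟨ cong (kappa t k +_) (trans (ΣFin-const t 1) (*-identityʳ t)) ⟩
  kappa t k + t                               ∎
  where open ≡-Reasoning

-- The left side is `2κ + 2t`, so the gap is `2κ - t`, at least `κ` and hence positive because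
-- `1 ≤ t ≤ κ`.
2Σk<4kappa+t : ∀ t k → 1 ≤ t → (∀ i → 2 ≤ k i) → 2 * ΣFin t k < 4 * kappa t k + t
2Σk<4kappa+t t k 1≤t 2≤k rewrite Σk≡kappa+t t k 2≤k = begin
  1 + 2 * (κ + t)          ≤⟨ +-monoˡ-≤ _ (≤-trans 1≤t t≤κ) ⟩
  κ + 2 * (κ + t)          ≡⟨ solve 2 (λ κ t → κ :+ con 2 :* (κ :+ t) := con 3 :* κ :+ t :+ t) refl κ t ⟩
  3 * κ + t + t            ≤⟨ +-monoʳ-≤ (3 * κ + t) t≤κ ⟩
  3 * κ + t + κ            ≡⟨ solve 2 (λ κ t → con 3 :* κ :+ t :+ κ := con 4 :* κ :+ t) refl κ t ⟩
  4 * κ + t                ∎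
  where
  open ≤-Reasoning
  κ   = kappa t k
  t≤κ = t≤kappa t k 2≤k

theorem3p6 : (t : ℕ) → 1 ≤ t → (k : Fin t → ℕ) → (∀ i → 2 ≤ k i) →
    (n : ℕ) → 2 ≤ n → (G : Graph n) → ¬ ContainsBouquet G t k →
    ΣFin n (λ u → degree G u ^ 2) < (4 * kappa t k + t) * (n ∸ 1) * n
theorem3p6 t 1≤t k 2≤k n@(suc (suc m)) (s≤s (s≤s z≤n)) G free =
  subst (_< C * n) (Σ-nbrDegreeSum G) (ΣFin-< n (nbrDegreeSum G) C z<s local)
  where
  C = (4 * kappa t k + t) * (n ∸ 1)
  1≤Σk : 1 ≤ ΣFin t k
  1≤Σk = subst (1 ≤_) (sym (Σk≡kappa+t t k 2≤k)) (≤-trans 1≤t (m≤n+m t _))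
  local : ∀ v → nbrDegreeSum G v < C
  local v with nbrDegreeSum G v <? C
  ... | yes lt = lt
  ... | no  ≮C = contradiction
    (nbrDegreeSum⇒bouquet G v t k 2≤k 1≤Σk
      -- The factor `n ∸ 1` is `suc m`, hence positive, and the strict inequality survives
      -- multiplication.
      (<-≤-trans (*-monoˡ-< (suc m) (2Σk<4kappa+t t k 1≤t 2≤k)) (≮⇒≥ ≮C)))
    free
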